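{- Let $\mathcal{F}$ and $\mathcal{F}'$ be hereditary classes of graphs and let $\theta$ be a positive integer. Let $\mathcal{F}^*$ be a class of graphs such that for every $G\in\mathcal{F}^*$ there exists a tree-decomposition $(T,\mathcal{X})$ of $G$ of adhesion at most $\theta$, where $\mathcal{X}=(X_t:t\in V(T))$, such that for every $t\in V(T)$: (i) $G[X_t]\in\mathcal{F}$, and (ii) $\mathcal{F}'$ contains every graph that can be obtained from $G[X_t]$ by adding new vertices and new edges such that for each new vertex $v$ there exists a neighbor $t_v$ of $t$ in $T$ such that all neighbors of $v$ are contained in $X_t\cap X_{t_v}$. Then $\operatorname{ad}(\mathcal{F}^*)\le\max\{\operatorname{ad}(\mathcal{F}),\operatorname{ad}(\mathcal{F}'),1\}$.
   Context: All graphs are finite. A class of graphs is hereditary if it is closed under taking induced subgraphs. $G[S]$ denotes the subgraph induced by $S$. A tree-decomposition $(T,\mathcal{X})$ of $G$ has adhesion $\max_{tt'\in E(T)}|X_t\cap X_{t'}|$. For a graph $G$ and $x,y\in V(G)$, $d_G(x,y)$ is the minimum number of edges of a path in $G$ between $x$ and $y$. For a nonnegative integer $n$, an $n$-dimensional control function for a class $\mathcal{F}$ of graphs is a function $f:\mathbb{R}^+\to\mathbb{R}^+$ such that for every $G\in\mathcal{F}$ and every real $r>0$ there exist collections $\mathcal{U}_1,\dots,\mathcal{U}_{n+1}$ of subsets of $V(G)$ covering $V(G)$, such that for each $i$, whenever $U\neq U'$ are in $\mathcal{U}_i$ and $x\in U$, $x'\in U'$, we have $d_G(x,x')>r$, and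 whenever $x,x'$ lie in a common $U\in\mathcal{U}_i$ we have $d_G(x,x')\le f(r)$. The asymptotic dimension $\operatorname{ad}(\mathcal{F})$ is the minimum $n$ for which there is a common $n$-dimensional control function for all graphs in $\mathcal{F}$. -}

module Defs where

open import Data.Nat using (ℕ; zero; suc; _+_; _≤_; _<_)
open import Data.Bool using (Bool; true; false)
open import Data.Fin using (Fin; zero; suc; inject₁; fromℕ; splitAt)
open import Data.Fin.Subset using (Subset; _∈_; _∩_; ∣_∣)
open import Data.Fin.Subset.Properties using (_∈?_)
open import Data.List using (List; length; lookup; filter; allFin)
open import Data.Sum using (_⊎_; inj₁; inj₂)
open import Data.Product using (Σ; ∃; _×_; _,_)
open import Relation.Binary.PropositionalEquality using (_≡_; _≢_; refl)
open import Relation.Nullary using (¬_)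

record Graph : Set where
  field
    n       : ℕ
    adj     : Fin n → Fin n → Bool
    adj-sym : ∀ x y → adj x y ≡ adj y x
    adj-irr : ∀ x → adj x x ≡ false

open Graph public

V : Graph → Set
V G = Fin (n G)

Class : Set₁
Class = Graph → Set

InducedSubgraphOf : Graph → Graph → Set
InducedSubgraphOf H G =
  Σ (V H → V G) λ φ →
    (∀ x y → φ x ≡ φ y → x ≡ y) ×
    (∀ x y → adj H x y ≡ adj G (φ x) (φ y))

Hereditary : Class → Set
Hereditary F = ∀ G H → F G → InducedSubgraphOf H G → F H

data Reach (G : Graph) : ℕ → V G → V G → Set where
  here : ∀ {k x} → Reach G k x x
  step : ∀ {k x y z} → adj G x y ≡ true → Reach G k y z → Reach G (suc k) x z

data PathIn (G : Graph) (P : V G → Set) : V G → V G → Set where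
  stop : ∀ {x} → P x → PathIn G P x x
  step : ∀ {x y z} → P x → adj G x y ≡ true → PathIn G P y z → PathIn G P x z

Cycle : Graph → Set
Cycle G = Σ ℕ λ k → Σ (Fin (suc (suc (suc k))) → V G) λ c →
  (∀ i j → c i ≡ c j → i ≡ j) ×
  (∀ (i : Fin (suc (suc k))) → adj G (c (inject₁ i)) (c (suc i)) ≡ true) ×
  (adj G (c (fromℕ (suc (suc k)))) (c zero) ≡ true)

IsTree : Graph → Set
IsTree T = (0 < n T) × (∀ x y → ∃ λ k → Reach T k x y) × ¬ Cycle T

record TreeDecomposition (G : Graph) : Set where
  field
    T       : Graph
    T-tree  : IsTree T
    bag     : V T → Subset (n G)
    covers  : ∀ v → ∃ λ t → v ∈ bag t
    edges   : ∀ u v → adj G u v ≡ true → ∃ λ t → (u ∈ bag t) × (v ∈ bag t)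
    connect : ∀ v t t' → v ∈ bag t → v ∈ bag t' → PathIn T (λ s → v ∈ bag s) t t'

open TreeDecomposition public

AdhesionAtMost : ∀ {G} → TreeDecomposition G → ℕ → Set
AdhesionAtMost D θ = ∀ t t' → adj (T D) t t' ≡ true → ∣ bag D t ∩ bag D t' ∣ ≤ θ

elems : ∀ {m} → Subset m → List (Fin m)
elems {m} S = filter (_∈? S) (allFin m)

Induced : (G : Graph) → Subset (n G) → Graph
Induced G S = record
  { n = length (elems S)
  ; adj = λ a b → adj G (lookup (elems S) a) (lookup (elems S) b)
  ; adj-sym = λ a b → adj-sym G (lookup (elems S) a) (lookup (elems S) b)
  ; adj-irr = λ a → adj-irr G (lookup (elems S) a)
  }

extAdj : (k m : ℕ) → (Fin k → Fin k → Bool) → (Fin m → Fin k → Bool) →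
         Fin (k + m) → Fin (k + m) → Bool
extAdj k m A N x y with splitAt k x | splitAt k y
... | inj₁ a | inj₁ b = A a b
... | inj₁ a | inj₂ j = N j a
... | inj₂ j | inj₁ a = N j a
... | inj₂ i | inj₂ j = false

extAdj-sym : ∀ k m A N → (∀ a b → A a b ≡ A b a) → ∀ x y → extAdj k m A N x y ≡ extAdj k m A N y x
extAdj-sym k m A N s x y with splitAt k x | splitAt k y
... | inj₁ a | inj₁ b = s a b
... | inj₁ a | inj₂ j = refl
... | inj₂ j | inj₁ a = refl
... | inj₂ i | inj₂ j = refl

extAdj-irr : ∀ k m A N → (∀ a → A a a ≡ false) → ∀ x → extAdj k m A N x x ≡ false
extAdj-irr k m A N s x with splitAt k x
... | inj₁ a = s a
... | inj₂ j = refl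

Extend : (B : Graph) (m : ℕ) → (Fin m → V B → Bool) → Graph
Extend B m N = record
  { n = n B + m
  ; adj = extAdj (n B) m (adj B) N
  ; adj-sym = extAdj-sym (n B) m (adj B) N (adj-sym B)
  ; adj-irr = extAdj-irr (n B) m (adj B) N (adj-irr B)
  }

-- d-dimensional control function (r and f(r) taken in ℕ).
ControlFunction : Class → ℕ → (ℕ → ℕ) → Set
ControlFunction F d f =
  ∀ G → F G → ∀ r → 0 < r →
  Σ (Fin (suc d) → ℕ) λ m →
  Σ ((i : Fin (suc d)) → Fin (m i) → Subset (n G)) λ U →
    (∀ x → ∃ λ i → ∃ λ j → x ∈ U i j) ×
    (∀ i j j' x x' → j ≢ j' → x ∈ U i j → x' ∈ U i j' → ¬ Reach G r x x') ×
    (∀ i j x x' → x ∈ U i j → x' ∈ U i j → Reach G (f r) x x')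

AsdimAtMost : Class → ℕ → Set
AsdimAtMost F d = Σ (ℕ → ℕ) (ControlFunction F d)

GoodDecomposition : Class → Class → ℕ → Graph → Set
GoodDecomposition F F' θ G =
  Σ (TreeDecomposition G) λ D →
    AdhesionAtMost D θ ×
    (∀ t → F (Induced G (bag D t))) ×
    (∀ t (m : ℕ) (N : Fin m → V (Induced G (bag D t)) → Bool) →
       (∀ j → ∃ λ t' → (adj (T D) t t' ≡ true) ×
          (∀ a → N j a ≡ true → lookup (elems (bag D t)) a ∈ bag D t')) →
       F' (Extend (Induced G (bag D t)) m N))

{-# OPTIONS --safe #-}

-- Work in the metric of G, and call a chain of equally coloured vertices with jumps at most r
-- monochromatic; the colouring sought has monochromatic chains of bounded diameter.
--
-- Adding to G[X_t] a vertex for each pair of close vertices in an adhesion set of t gives a graph of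
-- F' in which the bag has, at a given scale, the same metric as in G up to constants.  So all bags,
-- as subspaces of G, are uniformly coloured.
--
-- The colouring of G is by induction on the adhesion.  Cut the rooted tree into regions: a new region
-- starts below an edge whose adhesion set is far from the adhesion set S on top of the current region.
-- Within a region every adhesion set meets a ball around S; removing the ball lowers the adhesion, and
-- a ball around at most θ points is harmless, so the region is coloured by induction.  Consecutive
-- regions are decoupled near the adhesion set between them: the upper region imposes its colour on
-- each cluster of the fringe of the lower one, and the vertices around a cluster get another colour,
-- which is where two colours are needed.

module Submission where

open import Defs
open import Data.Bool using (Bool; true; false)
import Data.Bool.Properties as Bool
open import Data.Empty using (⊥; ⊥-elim)
open import Data.Fin using (Fin; zero; suc; inject₁; fromℕ; fromℕ<; _↑ˡ_; _↑ʳ_; splitAt)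
import Data.Fin.Properties as Fin
open import Data.Fin.Subset using (Subset; ∣_∣; _∩_) renaming (_∈_ to _∈ₛ_)
open import Data.Fin.Subset.Properties using (∣p∣≤∣x∷p∣; x∈p∩q⁺; x∈p∩q⁻; drop-there)
  renaming (_∈?_ to _∈ₛ?_)
open import Data.List
  using (List; []; _∷_; length; lookup; filter; allFin; tabulate; cartesianProduct)
open import Data.List.Membership.Propositional using (_∈_; find; lose)
open import Data.List.Membership.Propositional.Properties
  using (∈-allFin; ∈-cartesianProduct⁺; ∈-filter⁺; ∈-filter⁻; ∈-lookup)
open import Data.List.Properties using (filter-notAll; ≡-dec)
open import Data.List.Relation.Unary.All using ([]; _∷_)
import Data.List.Relation.Unary.All as All
open import Data.List.Relation.Unary.All.Properties using (¬Any⇒All¬)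
open import Data.List.Relation.Unary.AllPairs using ([]; _∷_)
open import Data.List.Relation.Unary.Unique.Propositional using (Unique)
open import Data.List.Relation.Unary.Unique.Propositional.Properties using (allFin⁺; filter⁺)
open import Data.List.Relation.Unary.Any.Properties using (lookup-index)
open import Data.List.Relation.Unary.Any using (Any; here; there; any?; index) renaming (map to Any-map)
open import Data.Nat using (ℕ; zero; suc; _+_; _*_; _≤_; _<_; z≤n; s≤s)
open import Data.Nat.Properties
open import Data.Product using (Σ; ∃; ∃₂; _×_; _,_; proj₁; proj₂)
open import Level using (0ℓ)
open import Data.Sum using (_⊎_; inj₁; inj₂)
open import Data.Unit using (⊤; tt)
import Data.Vec as Vec
open import Data.Vec using ([]; _∷_; here)
open import Data.Vec.Properties using (lookup⇒[]=; []=⇒lookup; lookup∘tabulate)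
open import Function using (_∘_; id; case_of_)
open import Relation.Binary using (Rel; Symmetric; DecidableEquality)
open import Relation.Binary.Construct.Closure.ReflexiveTransitive
  using (Star; ε; _◅_; _◅◅_; reverse)
  renaming (map to Star-map; gmap to Star-gmap)
open import Relation.Binary.PropositionalEquality
  using (_≡_; _≢_; refl; sym; trans; cong; cong₂; subst)
open import Relation.Nullary using (¬_; Dec; yes; no; does)
open import Relation.Nullary.Decidable using (_×-dec_; _⊎-dec_; ¬?; map′; dec-true; decidable-stable)

-- Distances, chains and balls around few points.

spread : ℕ → ℕ → ℕ → ℕ → ℕ
spread r W D zero = D
spread r W D (suc n) = (spread r W D n + (r + W)) + (spread r W D n + (r + W))

spread-≥ : ∀ r W D n → D ≤ spread r W D n
spread-≥ r W D zero = ≤-refl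
spread-≥ r W D (suc n) =
  ≤-trans (spread-≥ r W D n) (≤-trans (m≤m+n _ (r + W)) (m≤m+n _ _))

module _ {G : Graph} where

  reach-mono : ∀ {k l x y} → k ≤ l → Reach G k x y → Reach G l x y
  reach-mono _ here = here
  reach-mono (s≤s k≤l) (step e p) = step e (reach-mono k≤l p)

  reach-trans : ∀ {k l x y z} → Reach G k x y → Reach G l y z → Reach G (k + l) x z
  reach-trans {k} {l} here q = reach-mono (m≤n+m l k) q
  reach-trans (step e p) q = step e (reach-trans p q)

  reach-sym : ∀ {k x y} → Reach G k x y → Reach G k y x
  reach-sym here = here
  reach-sym {suc k} {x} {z} (step {y = y} e p) =
    subst (λ l → Reach G l z x) (+-comm k 1)
      (reach-trans (reach-sym p) (step (trans (adj-sym G y x) e) here))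

  reach? : ∀ k x y → Dec (Reach G k x y)
  reach? k x y with x Fin.≟ y
  reach? k x .x | yes refl = yes here
  reach? zero x y | no x≢y = no λ { here → x≢y refl }
  reach? (suc k) x y | no x≢y =
    map′ (λ (_ , e , p) → step e p)
         (λ { here → ⊥-elim (x≢y refl) ; (step e p) → _ , e , p })
         (Fin.any? λ z → (adj G x z Bool.≟ true) ×-dec reach? k z y)

  Near : ℕ → List (V G) → V G → Set
  Near W cs x = Any (Reach G W x) cs

  near? : ∀ W cs x → Dec (Near W cs x)
  near? W cs x = any? (reach? W x) cs

  near-mono : ∀ {W W' cs x} → W ≤ W' → Near W cs x → Near W' cs x
  near-mono le n = let _ , s∈ , p = find n in lose s∈ (reach-mono le p)

  near-shift : ∀ {k W cs x y} → Reach G k x y → Near W cs y → Near (k + W) cs x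
  near-shift p n = let _ , s∈ , q = find n in lose s∈ (reach-trans p q)

  Linked : (V G → Set) → Rel (V G) 0ℓ → Rel (V G) 0ℓ
  Linked A E x y = A x × A y × E x y

  linked-sym : ∀ A {E} → Symmetric E → Symmetric (Linked A E)
  linked-sym A s (a , b , e) = b , a , s e

  Tied : ∀ {m} → ℕ → (V G → Fin m) → Rel (V G) 0ℓ
  Tied r c x y = c x ≡ c y × Reach G r x y

  tied-sym : ∀ {m r} {c : V G → Fin m} → Symmetric (Tied r c)
  tied-sym (e , p) = sym e , reach-sym p

  Bounded : ∀ {m} → (V G → Set) → (V G → Fin m) → ℕ → ℕ → Set
  Bounded A c r D = ∀ {x y} → Star (Linked A (Tied r c)) x y → Reach G D x y

  first-hit : ∀ {r} {E : Rel (V G) 0ℓ} {Q Q' H : V G → Set} →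
    (∀ {x y} → E x y → Reach G r x y) → (∀ {x} → Q x → H x ⊎ Q' x) →
    ∀ {x y} → Star (Linked Q E) x y →
    Star (Linked Q' E) x y ⊎
    ∃₂ λ v u → Star (Linked Q' E) x v × Reach G r v u × H u
  first-hit E⊆ split ε = inj₁ ε
  first-hit E⊆ split ((qx , qy , e) ◅ w) with split qx
  ... | inj₁ hx = inj₂ (_ , _ , ε , here , hx)
  ... | inj₂ qx' with split qy
  ...   | inj₁ hy = inj₂ (_ , _ , ε , E⊆ e , hy)
  ...   | inj₂ qy' with first-hit E⊆ split w
  ...     | inj₁ w' = inj₁ ((qx' , qy' , e) ◅ w')
  ...     | inj₂ (v , u , w' , p , hu) = inj₂ (v , u , (qx' , qy' , e) ◅ w' , p , hu)

  -- Induction on the centres. A chain that never needs the ball around `s` is bounded by the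
  -- remaining centres alone. Otherwise the parts before the first hit, seen from either end, put
  -- both ends within `B + (r + W)` of `s`; hence the doubling in `spread`.
  chain-bound : ∀ {r W D} {E : Rel (V G) 0ℓ} {P : V G → Set} →
    Symmetric E → (∀ {x y} → E x y → Reach G r x y) →
    (∀ {x y} → Star (Linked P E) x y → Reach G D x y) →
    ∀ n cs → length cs ≤ n →
    ∀ {x y} → Star (Linked (λ z → Near W cs z ⊎ P z) E) x y → Reach G (spread r W D n) x y
  chain-bound {r} {W} {D} Es E⊆ b n [] _ w =
    reach-mono (spread-≥ r W D n)
      (b (Star-map (λ { (inj₂ p , inj₂ q , e) → p , q , e }) w))
  chain-bound {r} {W} {D} {E} {P} Es E⊆ b (suc n) (s ∷ cs) (s≤s le) {x} {y} w =
    join (hit w) (hit (reverse (linked-sym (λ z → Near W (s ∷ cs) z ⊎ P z) Es) w))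
    where
    B = spread r W D n
    Q' = λ z → Near W cs z ⊎ P z

    split : ∀ {z} → Near W (s ∷ cs) z ⊎ P z → Reach G W z s ⊎ Q' z
    split (inj₁ (here p)) = inj₁ p
    split (inj₁ (there p)) = inj₂ (inj₁ p)
    split (inj₂ p) = inj₂ (inj₂ p)

    hit : ∀ {x y} → Star (Linked (λ z → Near W (s ∷ cs) z ⊎ P z) E) x y →
      Reach G B x y ⊎ Reach G (B + (r + W)) x s
    hit w with first-hit E⊆ split w
    ... | inj₁ w' = inj₁ (chain-bound Es E⊆ b n cs le w')
    ... | inj₂ (v , u , w' , p , q) =
      inj₂ (reach-trans (chain-bound Es E⊆ b n cs le w') (reach-trans p q))

    join : Reach G B x y ⊎ Reach G (B + (r + W)) x s →
      Reach G B y x ⊎ Reach G (B + (r + W)) y s → Reach G (spread r W D (suc n)) x y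
    join (inj₁ p) _ = reach-mono (≤-trans (m≤m+n B _) (m≤m+n _ _)) p
    join (inj₂ _) (inj₁ q) = reach-mono (≤-trans (m≤m+n B _) (m≤m+n _ _)) (reach-sym q)
    join (inj₂ p) (inj₂ q) = reach-trans p (reach-sym q)

-- Union-find over all pairs. It makes each connected component of `E` available through one chosen
-- vertex.
representatives : ∀ {n} {E : Rel (Fin n) 0ℓ} → (∀ x y → Dec (E x y)) → Symmetric E →
  ∃ λ (rep : Fin n → Fin n) → (∀ {x y} → E x y → rep x ≡ rep y) × (∀ x → Star E x (rep x))
representatives {n} {E} E? Es =
  let rep , same , conn = go (cartesianProduct (allFin n) (allFin n))
  in rep , same (∈-cartesianProduct⁺ (∈-allFin _) (∈-allFin _)) , conn
  where
  go : ∀ ps → ∃ λ (rep : Fin n → Fin n) →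
    (∀ {x y} → (x , y) ∈ ps → E x y → rep x ≡ rep y) × (∀ x → Star E x (rep x))
  go [] = id , (λ ()) , λ _ → ε
  go ((a , b) ∷ ps) with go ps | E? a b
  ... | rep , same , conn | no ¬e =
    rep , (λ { (here refl) e → ⊥-elim (¬e e) ; (there i) e → same i e }) , conn
  ... | rep , same , conn | yes e = merge ∘ rep , same' , conn'
    where
    merge : Fin n → Fin n
    merge z with z Fin.≟ rep a
    ... | yes _ = rep b
    ... | no _ = z

    merge-a : merge (rep a) ≡ rep b
    merge-a with rep a Fin.≟ rep a
    ... | yes _ = refl
    ... | no ne = ⊥-elim (ne refl)

    merge-b : merge (rep b) ≡ rep b
    merge-b with rep b Fin.≟ rep a
    ... | yes _ = refl
    ... | no _ = refl

    same' : ∀ {x y} → (x , y) ∈ (a , b) ∷ ps → E x y → merge (rep x) ≡ merge (rep y)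
    same' (here refl) _ = trans merge-a (sym merge-b)
    same' (there i) e' = cong merge (same i e')

    conn' : ∀ x → Star E x (merge (rep x))
    conn' x with rep x Fin.≟ rep a
    ... | no _ = conn x
    ... | yes eq = subst (Star E x) eq (conn x) ◅◅ reverse Es (conn a) ◅◅ e ◅ conn b

-- The ancestor order on addresses.

infix 4 _⊑_

-- Suffix order; on addresses, `f ⊑ t` says that `f` is `t` or an ancestor of it.
data _⊑_ {N : Set} : List N → List N → Set where
  stop : ∀ {l} → l ⊑ l
  skip : ∀ {a l m} → l ⊑ m → l ⊑ a ∷ m

module _ {N : Set} where

  ⊑-trans : {k l m : List N} → k ⊑ l → l ⊑ m → k ⊑ m
  ⊑-trans p stop = p
  ⊑-trans p (skip q) = skip (⊑-trans p q)

  ⊑-length : {k l : List N} → k ⊑ l → length k ≤ length l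
  ⊑-length stop = ≤-refl
  ⊑-length (skip p) = m≤n⇒m≤1+n (⊑-length p)

  ∷⋢ : ∀ {a : N} {l} → ¬ (a ∷ l ⊑ l)
  ∷⋢ p = 1+n≰n (⊑-length p)

  ⊑-antisym : {k l : List N} → k ⊑ l → l ⊑ k → k ≡ l
  ⊑-antisym stop _ = refl
  ⊑-antisym (skip p) q = ⊥-elim (∷⋢ (⊑-trans q p))

  ⊑-comparable : {k l m : List N} → k ⊑ m → l ⊑ m → k ⊑ l ⊎ l ⊑ k
  ⊑-comparable stop q = inj₂ q
  ⊑-comparable p stop = inj₁ p
  ⊑-comparable (skip p) (skip q) = ⊑-comparable p q

  []⊑ : (l : List N) → [] ⊑ l
  []⊑ [] = stop
  []⊑ (_ ∷ l) = skip ([]⊑ l)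

  up : List N → List N
  up [] = []
  up (_ ∷ l) = l

  module _ (_≟_ : DecidableEquality N) where

    _⊑?_ : (k l : List N) → Dec (k ⊑ l)
    k ⊑? l with ≡-dec _≟_ k l
    k ⊑? .k | yes refl = yes stop
    k ⊑? [] | no k≢l = no λ { stop → k≢l refl }
    k ⊑? (a ∷ l) | no k≢l =
      map′ skip (λ { stop → ⊥-elim (k≢l refl) ; (skip p) → p }) (k ⊑? l)

-- A layout roots the tree: the nodes are addresses (the list of nodes from a node up to the root),
-- S (a ∷ f) is the adhesion set of the edge from a ∷ f to its parent f, and every vertex has one
-- home node.  A is the part of the graph still to be coloured.
record Layout (G : Graph) {N : Set} (X : List N → V G → Set) (β σ θ : ℕ) : Set₁ where
  field
    A        : V G → Set
    A?       : ∀ x → Dec (A x)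
    home     : V G → List N
    S        : List N → List (V G)
    S-size   : ∀ f → length (S f) ≤ θ
    S-bag    : ∀ {a f s} → s ∈ S (a ∷ f) → X f s
    home-bag : ∀ {x} → A x → ∃ λ y → X (home x) y × Reach G β x y
    sep      : ∀ {k f x y} → k ≤ σ → A x → A y → f ⊑ home x → ¬ f ⊑ home y →
               Reach G k x y → ∃ λ s → s ∈ S f × Reach G k x s × Reach G k s y

-- Cutting the rooted tree into regions.

module Regions {N : Set} (_≟_ : DecidableEquality N) {Close : List N → List N → Set}
  (close? : ∀ f e → Dec (Close f e)) where

  -- `reg t` is the root of the region of `t`; the region roots are the fixed points of `reg`.
  reg : List N → List N
  reg [] = []
  reg (a ∷ p) with close? (a ∷ p) (reg p)
  ... | yes _ = reg p
  ... | no _ = a ∷ p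

  reg-step : ∀ a p → (Close (a ∷ p) (reg p) × reg (a ∷ p) ≡ reg p) ⊎
                     (¬ Close (a ∷ p) (reg p) × reg (a ∷ p) ≡ a ∷ p)
  reg-step a p with close? (a ∷ p) (reg p)
  ... | yes c = inj₁ (c , refl)
  ... | no ¬c = inj₂ (¬c , refl)

  reg-⊑ : ∀ t → reg t ⊑ t
  reg-⊑ [] = stop
  reg-⊑ (a ∷ p) with reg-step a p
  ... | inj₁ (_ , eq) = subst (_⊑ a ∷ p) (sym eq) (skip (reg-⊑ p))
  ... | inj₂ (_ , eq) = subst (_⊑ a ∷ p) (sym eq) stop

  reg-idem : ∀ t → reg (reg t) ≡ reg t
  reg-idem [] = refl
  reg-idem (a ∷ p) with reg-step a p
  ... | inj₁ (_ , eq) = trans (cong reg eq) (trans (reg-idem p) (sym eq))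
  ... | inj₂ (_ , eq) = cong reg eq

  reg-mono : ∀ {e t} → e ⊑ t → reg e ≡ e → e ⊑ reg t
  reg-mono stop eq = subst (_ ⊑_) (sym eq) stop
  reg-mono (skip {a} {m = p} le) eq with reg-step a p
  ... | inj₁ (_ , eq') = subst (_ ⊑_) (sym eq') (reg-mono le eq)
  ... | inj₂ (_ , eq') = subst (_ ⊑_) (sym eq') (skip le)

  reg-∌ : ∀ {a p e} → reg p ≡ e → ¬ a ∷ p ⊑ e
  reg-∌ {p = p} refl le = ∷⋢ (⊑-trans le (reg-⊑ p))

  reg-far : ∀ {a p} → reg (a ∷ p) ≡ a ∷ p → ¬ Close (a ∷ p) (reg p)
  reg-far {a} {p} eq with reg-step a p
  ... | inj₁ (_ , eq') = ⊥-elim (reg-∌ refl (subst (a ∷ p ⊑_) (trans (sym eq) eq') stop))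
  ... | inj₂ (¬c , _) = ¬c

  reg-close : ∀ {f e} → reg f ≡ e → f ≢ e → Close f e
  reg-close {[]} eq ne = ⊥-elim (ne eq)
  reg-close {a ∷ p} eq ne with reg-step a p
  ... | inj₁ (c , eq') = subst (Close (a ∷ p)) (trans (sym eq') eq) c
  ... | inj₂ (_ , eq') = ⊥-elim (ne (trans (sym eq') eq))

  -- On the way down from `e` to `t`, take the first node where the region changes: its parent still
  -- belongs to the region of `e`.
  reg-child : ∀ {e t} → e ⊑ t → reg e ≡ e → reg t ≢ e →
    ∃₂ λ a p → reg (a ∷ p) ≡ a ∷ p × reg p ≡ e × a ∷ p ⊑ t
  reg-child stop eq ne = ⊥-elim (ne eq)
  reg-child {e} (skip {a} {m = p} le) eq ne with ≡-dec _≟_ (reg p) e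
  ... | no ne' =
    let b , q , r , s , t = reg-child le eq ne' in b , q , r , s , skip t
  ... | yes eq' with reg-step a p
  ...   | inj₁ (_ , eq'') = ⊥-elim (ne (trans eq'' eq'))
  ...   | inj₂ (_ , eq'') = a , p , eq'' , eq' , stop

-- The induction step: from adhesion `θ` to `suc θ`.

other : ∀ {d} → Fin (2 + d) → Fin (2 + d)
other zero = suc zero
other (suc _) = zero

other-≢ : ∀ {d} (i : Fin (2 + d)) → other i ≢ i
other-≢ zero ()
other-≢ (suc _) ()

-- Bounds a cluster of a fringe, which is chained by jumps of at most 2r inside the balls of radius
-- r around the at most θ + 1 points of an adhesion set.
fringe-diameter : ℕ → ℕ → ℕ
fringe-diameter r θ = spread (r + r) r 0 (suc θ)

-- The colouring for smaller adhesion must withstand longer jumps, because each end of a jump may be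
-- moved to a cluster representative as far away as the fringe diameter. The distance `β` to the bag
-- of the home grows by `r`, since fringe vertices are moved to the bag above.
module Step {G : Graph} {N : Set} (_≟_ : DecidableEquality N) {X : List N → V G → Set}
  {β r σ θ d D : ℕ} (L : Layout G X β (r + σ) (suc θ))
  (solve : (L' : Layout G X (β + r) σ θ) →
           ∃ λ (c : V G → Fin (2 + d)) →
             Bounded {G} (Layout.A L') c (r + (fringe-diameter r θ + fringe-diameter r θ)) D)
  where
  open Layout L

  Δ : ℕ
  Δ = fringe-diameter r θ

  _≟*_ : DecidableEquality (List N)
  _≟*_ = ≡-dec _≟_

  Close : List N → List N → Set
  Close f e = Any (Near {G} (r + r) (S e)) (S f)

  close? : ∀ f e → Dec (Close f e)
  close? f e = any? (near? (r + r) (S e)) (S f)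

  open Regions _≟_ close?

  at : V G → List N
  at x = reg (home x)

  Fringe : V G → Set
  Fringe x = A x × ∃ λ y → A y × ¬ at x ⊑ home y × Reach G r x y

  fringe? : ∀ x → Dec (Fringe x)
  fringe? x = A? x ×-dec Fin.any? λ y → A? y ×-dec (¬? (_⊑?_ _≟_ (at x) (home y)) ×-dec reach? r x y)

  sep-r : ∀ {f x y} → A x → A y → f ⊑ home x → ¬ f ⊑ home y →
    Reach G r x y → ∃ λ s → s ∈ S f × Reach G r x s × Reach G r s y
  sep-r = sep (m≤m+n r σ)

  close : ∀ {f e x s s'} → s ∈ S e → Reach G r x s → s' ∈ S f → Reach G r x s' → Close f e
  close s∈ p s'∈ p' = lose s'∈ (lose s∈ (reach-trans (reach-sym p') p))

  -- A jump out of a region root e starts in the region of e: otherwise it would also cross an edge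
  -- leaving that region, whose adhesion set is far from that of e.
  crossing : ∀ {e x y} → reg e ≡ e → A x → A y → e ⊑ home x → ¬ e ⊑ home y →
    Reach G r x y → at x ≡ e
  crossing {e} {x} er ax ay ex ey p with at x ≟* e
  ... | yes eq = eq
  ... | no ne =
    let a , q , fr , qe , fx = reg-child ex er ne
        s , s∈ , u , _ = sep-r ax ay ex ey p
        s' , s'∈ , u' , _ = sep-r ax ay fx
          (λ fy → ey (⊑-trans (subst (_⊑ a ∷ q) qe (skip (reg-⊑ q))) fy)) p
    in ⊥-elim (reg-far fr (subst (Close (a ∷ q)) (sym qe) (close s∈ u s'∈ u')))

  -- If `z` lay below a region root `f` hanging off the region of `e`, the jump between `z` and `x`
  -- would cross `S f`; then `x` would be within r of both `S e` and `S f`, making these close.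
  beside-crossing : ∀ {e x y z} → reg e ≡ e → A x → A y → A z → e ⊑ home x → ¬ e ⊑ home y →
    e ⊑ home z → Reach G r x y → Reach G r x z → at z ≡ e
  beside-crossing {e} {x} {y} {z} er ax ay az ex ey ez p p' with at z ≟* e
  ... | yes eq = eq
  ... | no ne =
    let a , q , fr , qe , fz = reg-child ez er ne
        s , s∈ , u , _ = sep-r ax ay ex ey p
        s' , s'∈ , _ , u' = sep-r az ax fz
          (λ fx → reg-∌ qe (subst (a ∷ q ⊑_) (crossing er ax ay ex ey p) (reg-mono fx fr)))
          (reach-sym p')
    in ⊥-elim (reg-far fr (subst (Close (a ∷ q)) (sym qe) (close s∈ u s'∈ (reach-sym u'))))

  at-⊑ : ∀ x → at x ⊑ home x
  at-⊑ x = reg-⊑ (home x)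

  at-root : ∀ {x e} → at x ≡ e → reg e ≡ e
  at-root {x} refl = reg-idem (home x)

  fringe-near : ∀ {x} → Fringe x → Near {G} r (S (at x)) x
  fringe-near {x} (ax , y , ay , ny , p) =
    let s , s∈ , u , _ = sep-r ax ay (at-⊑ x) ny p in lose s∈ u

  -- Jumps of 2r, so that two fringe vertices of one region within r of a common vertex share a
  -- cluster; `col-beside` relies on this.
  Cluster : Rel (V G) 0ℓ
  Cluster x y = Fringe x × Fringe y × at x ≡ at y × Reach G (r + r) x y

  cluster? : ∀ x y → Dec (Cluster x y)
  cluster? x y = fringe? x ×-dec (fringe? y ×-dec ((at x ≟* at y) ×-dec reach? (r + r) x y))

  cluster-sym : Symmetric Cluster
  cluster-sym (a , b , e , p) = b , a , sym e , reach-sym p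

  cluster-bound : ∀ {x y} → Star Cluster x y → Reach G Δ x y
  cluster-bound {x} w =
    chain-bound {P = λ _ → ⊥} reach-sym id (λ { ε → here })
      (suc θ) (S (at x)) (S-size (at x)) (chain refl w)
    where
    chain : ∀ {e x y} → at x ≡ e → Star Cluster x y →
      Star (Linked {G} (λ z → Near {G} r (S e) z ⊎ ⊥) (Reach G (r + r))) x y
    chain _ ε = ε
    chain refl ((a , b , eq , p) ◅ w) =
      (inj₁ (fringe-near a) , inj₁ (subst (λ e → Near r (S e) _) (sym eq) (fringe-near b)) , p)
      ◅ chain (sym eq) w

  cluster-fringe : ∀ {x y} → Star Cluster x y → Fringe x → Fringe y × at y ≡ at x
  cluster-fringe ε fx = fx , refl
  cluster-fringe ((_ , fy , eq , _) ◅ w) _ =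
    let fz , eq' = cluster-fringe w fy in fz , trans eq' (sym eq)

  reps = representatives cluster? cluster-sym

  rep : V G → V G
  rep = proj₁ reps

  rep-cong : ∀ {x y} → Cluster x y → rep x ≡ rep y
  rep-cong = proj₁ (proj₂ reps)

  rep-chain : ∀ x → Star Cluster x (rep x)
  rep-chain = proj₂ (proj₂ reps)

  -- The subproblem of a region root e: its region together with the fringes of the regions hanging
  -- off it, minus a ball around S e.  Every adhesion set inside the region meets that ball, and so
  -- loses an element.
  module Sub (e : List N) where

    Below : List N → Set
    Below l = ∃₂ λ a p → l ≡ a ∷ p × reg p ≡ e

    below? : ∀ l → Dec (Below l)
    below? [] = no λ ()
    below? (a ∷ p) = map′ (λ q → a , p , refl , q) (λ { (_ , _ , refl , q) → q }) (reg p ≟* e)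

    Inside : V G → Set
    Inside x = at x ≡ e ⊎ (Fringe x × Below (at x))

    A' : V G → Set
    A' x = (A x × Inside x) × ¬ Near {G} (r + r + σ) (S e) x

    A'? : ∀ x → Dec (A' x)
    A'? x = (A? x ×-dec ((at x ≟* e) ⊎-dec (fringe? x ×-dec below? (at x))))
      ×-dec ¬? (near? (r + r + σ) (S e) x)

    -- A fringe vertex of a region hanging off that of `e` moves up to the parent of its region
    -- root, a node in the region of `e`.
    home' : V G → List N
    home' x with at x ≟* e
    ... | yes _ = home x
    ... | no _ = up (at x)

    home'-view : ∀ {x} → Inside x →
      (at x ≡ e × home' x ≡ home x) ⊎
      (Fringe x × ∃₂ λ a p → at x ≡ a ∷ p × reg p ≡ e × home' x ≡ p)
    home'-view {x} i with at x ≟* e | i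
    ... | yes eq | _ = inj₁ (eq , refl)
    ... | no ne | inj₁ eq = ⊥-elim (ne eq)
    ... | no _ | inj₂ (fr , a , p , eq , eq') = inj₂ (fr , a , p , eq , eq' , cong up eq)

    home'-reg : ∀ {x} → Inside x → reg (home' x) ≡ e
    home'-reg i with home'-view i
    ... | inj₁ (eq , h) = trans (cong reg h) eq
    ... | inj₂ (_ , _ , _ , _ , eq , h) = trans (cong reg h) eq

    home'-⊑ : ∀ {x} → Inside x → home' x ⊑ home x
    home'-⊑ {x} i with home'-view i
    ... | inj₁ (_ , h) = subst (_⊑ home x) (sym h) stop
    ... | inj₂ (_ , _ , _ , eq , _ , h) =
      subst (_⊑ home x) (sym h) (⊑-trans (skip stop) (subst (_⊑ home x) eq (at-⊑ x)))

    -- Moving homes up loses no ancestor in the region of `e`: a node at or below `a ∷ p` has its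
    -- region root there too.
    home'-⊒ : ∀ {f x} → Inside x → reg f ≡ e → f ⊑ home x → f ⊑ home' x
    home'-⊒ {f} {x} i fe fx with home'-view i
    ... | inj₁ (_ , h) = subst (f ⊑_) (sym h) fx
    ... | inj₂ (_ , a , p , eq , pe , h) with ⊑-comparable fx (subst (_⊑ home x) eq (at-⊑ x))
    ...   | inj₁ (skip fp) = subst (f ⊑_) (sym h) fp
    ...   | inj₁ stop = ⊥-elim (reg-∌ pe (subst (a ∷ p ⊑_) (trans (sym (at-root eq)) fe) stop))
    ...   | inj₂ le = ⊥-elim (reg-∌ pe (subst (a ∷ p ⊑_) fe (reg-mono le (at-root eq))))

    inner? : ∀ f → Dec (reg f ≡ e × f ≢ e)
    inner? f = (reg f ≟* e) ×-dec ¬? (f ≟* e)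

    far? : ∀ s → Dec (¬ Near {G} (r + r) (S e) s)
    far? s = ¬? (near? (r + r) (S e) s)

    -- Filtering drops at least one element, because an inner node is close to `e`. Other nodes
    -- separate no two vertices of `A'`, so the empty list serves there.
    S' : List N → List (V G)
    S' f with inner? f
    ... | yes _ = filter far? (S f)
    ... | no _ = []

    S'-size : ∀ f → length (S' f) ≤ θ
    S'-size f with inner? f
    ... | no _ = z≤n
    ... | yes (fe , ne) =
      ≤-pred (≤-trans (filter-notAll far? (S f) (Any-map (λ n ¬n → ¬n n) (reg-close fe ne))) (S-size f))

    S'-⊆ : ∀ {f s} → s ∈ S' f → s ∈ S f
    S'-⊆ {f} i with inner? f
    ... | yes _ = proj₁ (∈-filter⁻ far? i)

    S'-∈ : ∀ {f s} → reg f ≡ e → f ≢ e → ¬ Near {G} (r + r) (S e) s → s ∈ S f → s ∈ S' f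
    S'-∈ {f} fe ne ns i with inner? f
    ... | yes _ = ∈-filter⁺ far? i ns
    ... | no n = ⊥-elim (n (fe , ne))

    home'-bag : ∀ {x} → A' x → ∃ λ y → X (home' x) y × Reach G (β + r) x y
    home'-bag {x} ((ax , i) , _) with home'-view i
    ... | inj₁ (_ , h) =
      let y , xy , p = home-bag ax
      in y , subst (λ l → X l y) (sym h) xy , reach-mono (m≤m+n β r) p
    ... | inj₂ (fr , a , p , eq , _ , h) =
      -- The fringe is near the adhesion set between `a ∷ p` and `p`, whose points lie in the bag of
      -- `p`.
      let s , s∈ , q = find (fringe-near fr)
      in s , subst (λ l → X l s) (sym h) (S-bag (subst (λ l → s ∈ S l) eq s∈)) ,
         reach-mono (m≤n+m r β) q

    -- The separator `s` found in `S f` survives the filter: if it were within 2r of `S e`, then `x`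
    -- would be within 2r + σ of `S e`, in the ball removed from `A'`.
    sep' : ∀ {k f x y} → k ≤ σ → A' x → A' y → f ⊑ home' x → ¬ f ⊑ home' y →
      Reach G k x y → ∃ λ s → s ∈ S' f × Reach G k x s × Reach G k s y
    sep' {k} {f} {x} {y} k≤σ ((ax , ix) , nx) ((ay , iy) , _) fx fy p =
      let s , s∈ , u , v = sep (≤-trans k≤σ (m≤n+m σ r)) ax ay (⊑-trans fx (home'-⊑ ix))
                             (λ fy' → fy (home'-⊒ iy fe fy')) p
      in s , S'-∈ fe f≢e
               (λ n → nx (near-mono (≤-trans (+-monoˡ-≤ (r + r) k≤σ) (≤-reflexive (+-comm σ (r + r))))
                                    (near-shift u n))) s∈ , u , v
      where
      e⊑y : e ⊑ home' y
      e⊑y = subst (_⊑ home' y) (home'-reg iy) (reg-⊑ (home' y))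

      e⊑x : e ⊑ home' x
      e⊑x = subst (_⊑ home' x) (home'-reg ix) (reg-⊑ (home' x))

      f≢e : f ≢ e
      f≢e refl = fy e⊑y

      er : reg e ≡ e
      er = trans (cong reg (sym (home'-reg ix))) (trans (reg-idem (home' x)) (home'-reg ix))

      fe : reg f ≡ e
      fe with ⊑-comparable fx e⊑x
      ... | inj₁ f⊑e = ⊥-elim (fy (⊑-trans f⊑e e⊑y))
      ... | inj₂ e⊑f = ⊑-antisym
        (subst (reg f ⊑_) (home'-reg ix) (reg-mono (⊑-trans (reg-⊑ f) fx) (reg-idem f)))
        (reg-mono e⊑f er)

    layout : Layout G X (β + r) σ θ
    layout = record
      { A = A' ; A? = A'? ; home = home' ; S = S' ; S-size = S'-size
      ; S-bag = λ i → S-bag (S'-⊆ i) ; home-bag = home'-bag ; sep = sep' }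

  c : List N → V G → Fin (2 + d)
  c e = proj₁ (solve (Sub.layout e))

  c-bounded : ∀ e → Bounded {G} (Sub.A' e) (c e) (r + (Δ + Δ)) D
  c-bounded e = proj₂ (solve (Sub.layout e))

  -- `reg (up (at x))` is the root of the region above; evaluating at `rep x` makes the colour
  -- constant on clusters.
  fringe-colour : V G → Fin (2 + d)
  fringe-colour x = c (reg (up (at x))) (rep x)

  Beside : V G → Set
  Beside x = ∃ λ q → Fringe q × at q ≡ at x × Reach G r x q

  beside? : ∀ x → Dec (Beside x)
  beside? x = Fin.any? λ q → fringe? q ×-dec ((at q ≟* at x) ×-dec reach? r x q)

  -- A fringe carries, cluster by cluster, the colour given by the region above it; its neighbourhood
  -- gets another colour, which stops every monochromatic chain from passing through.
  col : V G → Fin (2 + d)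
  col x with fringe? x | beside? x
  ... | yes _ | _ = fringe-colour x
  ... | no _ | yes (q , _) = other (fringe-colour q)
  ... | no _ | no _ = c (at x) x

  col-fringe : ∀ {x} → Fringe x → col x ≡ fringe-colour x
  col-fringe {x} fx with fringe? x | beside? x
  ... | yes _ | _ = refl
  ... | no nf | _ = ⊥-elim (nf fx)

  col-plain : ∀ {x} → ¬ Fringe x → ¬ Beside x → col x ≡ c (at x) x
  col-plain {x} nf nb with fringe? x | beside? x
  ... | yes f | _ = ⊥-elim (nf f)
  ... | no _ | yes b = ⊥-elim (nb b)
  ... | no _ | no _ = refl

  fringe-colour-cong : ∀ {x y} → Cluster x y → fringe-colour x ≡ fringe-colour y
  fringe-colour-cong cl@(_ , _ , eq , _) = cong₂ (λ l z → c (reg (up l)) z) eq (rep-cong cl)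

  col-beside : ∀ {x q} → ¬ Fringe x → Fringe q → at q ≡ at x → Reach G r x q → col x ≢ col q
  col-beside {x} {q} nf fq eq p same with fringe? x | beside? x
  ... | yes f | _ = nf f
  ... | no _ | no nb = nb (q , fq , eq , p)
  ... | no _ | yes (q' , fq' , eq' , p') =
    other-≢ (fringe-colour q')
      (trans same (trans (col-fringe fq)
        (fringe-colour-cong (fq , fq' , trans eq (sym eq') , reach-trans (reach-sym p) p'))))

  -- By level-step, a monochromatic chain never leaves the level of a region root.
  Level : List N → V G → Set
  Level e x = (at x ≡ e × ¬ Fringe x) ⊎ (Fringe x × Sub.Below e (at x))

  level : ∀ {x} → A x → ∃ λ e → reg e ≡ e × Level e x
  level {x} ax with fringe? x
  ... | no nf = at x , reg-idem (home x) , inj₁ (refl , nf)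
  ... | yes fx = go (at x) refl
    where
    go : ∀ l → at x ≡ l → ∃ λ e → reg e ≡ e × Level e x
    -- Every address has `[]` as a suffix, so the region of `[]` has no fringe.
    go [] eq = let _ , y , _ , ny , _ = fx in ⊥-elim (ny (subst (_⊑ home y) (sym eq) ([]⊑ (home y))))
    go (a ∷ p) eq = reg p , reg-idem p , inj₂ (fx , a , p , eq , refl)

  level-⊑ : ∀ {e x} → Level e x → e ⊑ home x
  level-⊑ {x = x} (inj₁ (refl , _)) = at-⊑ x
  level-⊑ {x = x} (inj₂ (_ , a , p , eq , refl)) =
    ⊑-trans (⊑-trans (reg-⊑ p) (skip stop)) (subst (_⊑ home x) eq (at-⊑ x))

  below-≢ : ∀ {e l} → Sub.Below e l → l ≢ e
  below-≢ (a , p , refl , pe) eq = reg-∌ pe (subst (a ∷ p ⊑_) eq stop)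

  -- Where the jump crosses or runs beside the border of a region, the crossing lemmas locate both
  -- ends. What remains are jumps between a fringe and its neighbourhood within one region, and
  -- there `col-beside` contradicts the equal colours.
  level-step : ∀ {e x y} → reg e ≡ e → A x → A y → col x ≡ col y → Reach G r x y →
    Level e x → Level e y
  level-step {e} {x} {y} er ax ay same p lx with _⊑?_ _≟_ e (home y)
  level-step er ax ay same p (inj₁ (refl , nf)) | no ny = ⊥-elim (nf (ax , _ , ay , ny , p))
  level-step er ax ay same p lx@(inj₂ (_ , bx)) | no ny =
    ⊥-elim (below-≢ bx (crossing er ax ay (level-⊑ lx) ny p))
  level-step {e} {x} {y} er ax ay same p lx | yes ey with at y ≟* e
  level-step {e} {x} {y} er ax ay same p (inj₁ (xe , nf)) | yes ey | yes ye =
    inj₁ (ye , λ fy → col-beside nf fy (trans ye (sym xe)) p same)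
  level-step {e} {x} {y} er ax ay same p lx@(inj₂ (_ , bx)) | yes ey | yes ye =
    inj₁ (ye , λ (_ , z , az , nz , q) →
      below-≢ bx (beside-crossing er ay az ax ey (λ ez → nz (subst (_⊑ home z) (sym ye) ez))
        (level-⊑ lx) q (reach-sym p)))
  level-step {e} {x} {y} er ax ay same p lx | yes ey | no ne with reg-child ey er ne
  ... | a , q , fr , qe , fy with _⊑?_ _≟_ (a ∷ q) (home x)
  ...   | no nfx =
    let yf = crossing fr ay ax fy nfx (reach-sym p)
    in inj₂ ((ay , x , ax , (λ le → nfx (subst (_⊑ home x) yf le)) , reach-sym p) , a , q , yf , qe)
  ...   | yes fx with lx
  ...     | inj₁ (xe , _) = ⊥-elim (reg-∌ qe (subst (a ∷ q ⊑_) xe (reg-mono fx fr)))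
  ...     | inj₂ (fringe-x@(_ , z , az , nz , pz) , a' , q' , xe , q'e) = inj₂ (fringe-y , a , q , yf , qe)
    where
    xf : at x ≡ a ∷ q
    xf with subst (a ∷ q ⊑_) xe (reg-mono fx fr)
    ... | stop = xe
    ... | skip le = ⊥-elim (reg-∌ qe (subst (a ∷ q ⊑_) q'e (reg-mono le fr)))

    yf : at y ≡ a ∷ q
    yf = beside-crossing fr ax az ay fx (λ le → nz (subst (_⊑ home z) (sym xf) le)) fy pz p

    fringe-y : Fringe y
    fringe-y = decidable-stable (fringe? y)
      λ nf → col-beside nf fringe-x (trans xf (sym yf)) (reach-sym p) (sym same)

  -- Trading fringe vertices for their representatives turns `col` into `c e` on the good part of a
  -- level, at a cost of `Δ` per end.
  π : V G → V G
  π x with fringe? x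
  ... | yes _ = rep x
  ... | no _ = x

  π-fringe : ∀ {x} → Fringe x → π x ≡ rep x
  π-fringe {x} f with fringe? x
  ... | yes _ = refl
  ... | no nf = ⊥-elim (nf f)

  π-plain : ∀ {x} → ¬ Fringe x → π x ≡ x
  π-plain {x} nf with fringe? x
  ... | yes f = ⊥-elim (nf f)
  ... | no _ = refl

  π-close : ∀ x → Reach G Δ x (π x)
  π-close x with fringe? x
  ... | yes _ = cluster-bound (rep-chain x)
  ... | no _ = here

  -- The radius of the ball removed in `Sub`, plus `Δ` for going from a fringe vertex to its
  -- representative.
  W : ℕ
  W = Δ + (r + r + σ)

  Good : List N → V G → Set
  Good e x = Sub.A' e (π x) × col x ≡ c e (π x)

  classify : ∀ {e x} → A x → Level e x → Near {G} W (S e) x ⊎ Good e x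
  classify {e} {x} ax (inj₁ (xe , nf)) = go (beside? x) (near? (r + r + σ) (S e) x)
    where
    go : Dec (Beside x) → Dec (Near {G} (r + r + σ) (S e) x) → Near {G} W (S e) x ⊎ Good e x
    -- `x` is within r of `q`, and `q`, being in the fringe, is within r of `S e`.
    go (yes (q , fq , eq , p)) _ =
      inj₁ (near-mono (≤-trans (m≤m+n (r + r) σ) (m≤n+m _ Δ))
        (near-shift p (subst (λ l → Near {G} r (S l) q) (trans eq xe) (fringe-near fq))))
    go (no _) (yes n) = inj₁ (near-mono (m≤n+m _ Δ) n)
    go (no nb) (no n) = inj₂
      ( subst (Sub.A' e) (sym (π-plain nf)) ((ax , inj₁ xe) , n)
      , trans (col-plain nf nb) (cong₂ c xe (sym (π-plain nf))) )
  classify {e} {x} ax (inj₂ (fx , bx@(a , p , eq , pe))) = go (near? (r + r + σ) (S e) (rep x))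
    where
    go : Dec (Near {G} (r + r + σ) (S e) (rep x)) → Near {G} W (S e) x ⊎ Good e x
    go (yes n) = inj₁ (near-shift (cluster-bound (rep-chain x)) n)
    go (no n) =
      let fr , eq' = cluster-fringe (rep-chain x) fx
      in inj₂
        ( subst (Sub.A' e) (sym (π-fringe fx))
            ((proj₁ fr , inj₂ (fr , subst (Sub.Below e) (sym eq') bx)) , n)
        , trans (col-fringe fx)
            (cong₂ c (trans (cong (reg ∘ up) eq) pe) (sym (π-fringe fx))) )

  bound : ℕ
  bound = spread r W (Δ + (D + Δ)) (suc θ)

  col-bounded : Bounded {G} A col r bound
  col-bounded ε = here
  col-bounded {x} {y} w@((ax , _) ◅ _) =
    let e , er , lx = level ax
    in chain-bound tied-sym proj₂ (good-chain e) (suc θ) (S e) (S-size e) (lift er lx w)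
    where
    lift : ∀ {e x y} → reg e ≡ e → Level e x → Star (Linked {G} A (Tied r col)) x y →
      Star (Linked {G} (λ z → Near {G} W (S e) z ⊎ Good e z) (Tied r col)) x y
    lift er lx ε = ε
    lift er lx ((ax , ay , eq , p) ◅ w) =
      let ly = level-step er ax ay eq p lx
      in (classify ax lx , classify ay ly , eq , p) ◅ lift er ly w

    good-chain : ∀ e {x y} → Star (Linked {G} (Good e) (Tied r col)) x y →
      Reach G (Δ + (D + Δ)) x y
    good-chain e {x} {y} w =
      reach-trans (π-close x) (reach-trans
        (c-bounded e (Star-gmap π
          (λ { {x} {y} ((ax , cx) , (ay , cy) , eq , p) → ax , ay , trans (sym cx) (trans eq cy) ,
               reach-mono (≤-reflexive
                 (trans (cong (Δ +_) (+-comm r Δ)) (trans (sym (+-assoc Δ Δ r)) (+-comm (Δ + Δ) r))))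
               (reach-trans (reach-sym (π-close x)) (reach-trans p (π-close y))) }) w))
        (reach-sym (π-close y)))

-- Induction on the adhesion.

Controlled : ℕ → (G : Graph) {N : Set} → (List N → V G → Set) → (ℕ → ℕ → ℕ) → Set
Controlled m G X g = ∀ l β r →
  ∃ λ (c : V G → Fin m) → Bounded {G} (λ x → ∃ λ y → X l y × Reach G β x y) c r (g β r)

-- `σ` and `D` are chosen before the graph, so the bound is uniform over the class. For `θ = 0` all
-- adhesion sets are empty, jumps of at most r never change the home, and the bags are coloured
-- independently.
layout-colouring : ∀ {d} (g : ℕ → ℕ → ℕ) θ β r → ∃₂ λ σ D →
  ∀ {G} {N : Set} → DecidableEquality N → (X : List N → V G → Set) →
  Controlled (2 + d) G X g → (L : Layout G X β σ θ) →
  ∃ λ (c : V G → Fin (2 + d)) → Bounded {G} (Layout.A L) c r D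
layout-colouring g zero β r = r , g β r , λ {G} {N} _≟_ X ctl L → colour _≟_ X ctl L
  where
  colour : ∀ {d G} {N : Set} → DecidableEquality N → (X : List N → V G → Set) →
    Controlled (2 + d) G X g → (L : Layout G X β r zero) →
    ∃ λ (c : V G → Fin (2 + d)) → Bounded {G} (Layout.A L) c r (g β r)
  colour {G = G} _≟_ X ctl L = c , λ w → bounded w
    where
    open Layout L

    c : V G → Fin _
    c x = proj₁ (ctl (home x) β r) x

    inside : ∀ {f x y} → A x → A y → f ⊑ home x → Reach G r x y → f ⊑ home y
    inside {f} {y = y} ax ay fx p = decidable-stable (_⊑?_ _≟_ f (home y)) λ ny →
      let _ , s∈ , _ = sep ≤-refl ax ay fx ny p
      in no-member (S f) (S-size f) s∈
      where
      no-member : ∀ xs {s} → length xs ≤ 0 → ¬ s ∈ xs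
      no-member [] _ ()

    chain : ∀ {l x y} → home x ≡ l → Star (Linked {G} A (Tied r c)) x y →
      Star (Linked {G} (λ x → ∃ λ y → X l y × Reach G β x y) (Tied r (proj₁ (ctl l β r)))) x y
    chain _ ε = ε
    chain {x = x} refl (_◅_ {j = z} (ax , az , eq , p) w) =
      (home-bag ax , subst (λ l → ∃ λ y → X l y × Reach G β z y) same (home-bag az) ,
        trans eq (cong (λ l → proj₁ (ctl l β r) z) same) , p) ◅ chain same w
      where
      same : home z ≡ home x
      same = ⊑-antisym (inside az ax stop (reach-sym p)) (inside ax az stop p)

    bounded : Bounded {G} A c r (g β r)
    bounded {x} w = proj₂ (ctl (home x) β r) (chain refl w)
layout-colouring {d} g (suc θ) β r = r + σ , bound , λ {G} _≟_ X ctl L →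
  Step.col _≟_ L (solve _≟_ X ctl) , Step.col-bounded _≟_ L (solve _≟_ X ctl)
  where
  Δ = fringe-diameter r θ
  rec = layout-colouring {d} g θ (β + r) (r + (Δ + Δ))
  σ = proj₁ rec
  D = proj₁ (proj₂ rec)
  solve = proj₂ (proj₂ rec)
  bound = spread r (Δ + (r + r + σ)) (Δ + (D + Δ)) (suc θ)

-- Paths in trees.

lookup-injective : ∀ {A : Set} {l : List A} → Unique l → ∀ i j → lookup l i ≡ lookup l j → i ≡ j
lookup-injective {l = _ ∷ _} _ zero zero _ = refl
lookup-injective {l = _ ∷ l} (h ∷ _) zero (suc j) eq = ⊥-elim (All.lookup h (∈-lookup {xs = l} j) eq)
lookup-injective {l = _ ∷ l} (h ∷ _) (suc i) zero eq =
  ⊥-elim (All.lookup h (∈-lookup {xs = l} i) (sym eq))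
lookup-injective {l = _ ∷ _} (_ ∷ u) (suc i) (suc j) eq = cong suc (lookup-injective u i j eq)

module _ (T : Graph) where

  open import Data.List.Membership.DecPropositional (Fin._≟_ {n T}) using () renaming (_∈?_ to _∈ₗ?_)

  -- The list index omits the first vertex, so that `t ∷ l` is an address.
  data Path : V T → V T → List (V T) → Set where
    stop : ∀ {u} → Path u u []
    cons : ∀ {u v t l} → adj T u v ≡ true → Path v t l → ¬ u ∈ v ∷ l → Path u t (v ∷ l)

  path-unique : ∀ {u t l} → Path u t l → Unique (u ∷ l)
  path-unique stop = [] ∷ []
  path-unique (cons _ p n) = ¬Any⇒All¬ _ n ∷ path-unique p

  path-adj : ∀ {u t l} → Path u t l → ∀ (i : Fin (length l)) →
    adj T (lookup (u ∷ l) (inject₁ i)) (lookup (u ∷ l) (suc i)) ≡ true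
  path-adj (cons e p _) zero = e
  path-adj (cons _ p _) (suc i) = path-adj p i

  path-last : ∀ {u t l} → Path u t l → lookup (u ∷ l) (fromℕ (length l)) ≡ t
  path-last stop = refl
  path-last (cons _ p _) = path-last p

  path-end : ∀ {u t l} → Path u t l → t ∈ u ∷ l
  path-end stop = here refl
  path-end (cons _ p _) = there (path-end p)

  path-suffix : ∀ {u t l x} → Path u t l → x ∈ u ∷ l → ∃ λ l' → Path x t l'
  path-suffix p (here refl) = _ , p
  path-suffix (cons _ p _) (there i) = path-suffix p i

  path-prefix : ∀ {u t l x} → Path u t l → x ∈ u ∷ l →
    ∃ λ l' → Path u x l' × (∀ {z} → z ∈ u ∷ l' → z ∈ u ∷ l)
  path-prefix p (here refl) = [] , stop , λ { (here eq) → here eq }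
  path-prefix (cons e p n) (there i) =
    let _ , p' , sub = path-prefix p i
    in _ , cons e p' (n ∘ sub) , λ { (here eq) → here eq ; (there j) → there (sub j) }

  reach-path : ∀ {k u t} → Reach T k u t → ∃ λ l → Path u t l
  reach-path here = [] , stop
  reach-path (step {x = u} {y = v} e w) with reach-path w
  ... | l , p with u ∈ₗ? (v ∷ l)
  ...   | yes i = path-suffix p i
  ...   | no n = _ , cons e p n

  module _ (acyclic : ¬ Cycle T) where

    -- Were `t` further along the path than its second vertex, the part up to `t` would close up
    -- with the edge to a cycle.
    retrace : ∀ {t u r l} → adj T t u ≡ true → Path u r l → t ∈ u ∷ l → ∃ λ l' → l ≡ t ∷ l'
    retrace e p (here refl) with trans (sym e) (adj-irr T _)
    ... | ()
    retrace e (cons _ _ _) (there (here refl)) = _ , refl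
    retrace {t} {u} e (cons {v = v} e' (cons {v = w} e'' p n') n) (there (there i)) with path-prefix p i
    ... | l' , p' , sub = ⊥-elim (acyclic
      ( length l'
      , lookup (u ∷ v ∷ w ∷ l')
      , lookup-injective (path-unique q)
      , path-adj q
      , subst (λ z → adj T z u ≡ true) (sym (path-last q)) e ))
      where
      q = cons e' (cons e'' p' (n' ∘ sub))
            (λ { (here eq) → n (here eq) ; (there j) → n (there (sub j)) })

    -- Prepending the first path, reversed, to a second one that leaves u differently never retraces
    -- a step, so it stays a path; but its two ends coincide.
    no-divergence : ∀ {u r l x w} → Path u r l → Path u r (x ∷ w) →
      (∀ {l'} → l ≢ x ∷ l') → ⊥
    no-divergence stop (cons _ p n) _ = n (path-end p)
    no-divergence {u} {x = x} {w} (cons {v = v} {l = l} e p n) q d =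
      no-divergence p (cons e' q fresh) λ { refl → n (there (here refl)) }
      where
      e' : adj T v u ≡ true
      e' = trans (adj-sym T v u) e

      fresh : ¬ v ∈ u ∷ x ∷ w
      fresh i with retrace e' q i
      ... | _ , refl = d refl

    path-irrelevant : ∀ {u r l l'} → Path u r l → Path u r l' → l ≡ l'
    path-irrelevant stop stop = refl
    path-irrelevant stop (cons _ p n) = ⊥-elim (n (path-end p))
    path-irrelevant (cons _ p n) stop = ⊥-elim (n (path-end p))
    path-irrelevant (cons {v = v} e p n) q@(cons {v = v'} _ p' _) with v Fin.≟ v'
    ... | yes refl = cong (v ∷_) (path-irrelevant p p')
    ... | no ne = ⊥-elim (no-divergence (cons e p n) q λ { refl → ne refl })

    -- Either `t` can be prepended to the path of `u`, or that path begins by stepping to `t`;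
    -- uniqueness of paths does the rest. So adjacent nodes are parent and child.
    path-edge : ∀ {t u r l l'} → adj T t u ≡ true → Path t r l → Path u r l' →
      l ≡ u ∷ l' ⊎ l' ≡ t ∷ l
    path-edge {t} {u} {l' = l'} e p q with t ∈ₗ? (u ∷ l')
    ... | no n = inj₁ (path-irrelevant p (cons e q n))
    ... | yes i with retrace e q i | q
    ...   | _ , refl | cons _ q' _ = inj₂ (cong (t ∷_) (path-irrelevant q' p))

-- Tree-decompositions as layouts.

filter-tabulate-length : ∀ {m n} (p : Subset n) {P : Fin m → Set} (P? : ∀ x → Dec (P x))
  (f : Fin n → Fin m) → (∀ i → P (f i) → i ∈ₛ p) → length (filter P? (tabulate f)) ≤ ∣ p ∣
filter-tabulate-length [] P? f h = z≤n
filter-tabulate-length (b ∷ p) P? f h with P? (f zero)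
... | no _ =
  ≤-trans (filter-tabulate-length p P? (f ∘ suc) (λ i q → drop-there (h (suc i) q))) (∣p∣≤∣x∷p∣ b p)
... | yes q with h zero q
...   | here = s≤s (filter-tabulate-length p P? (f ∘ suc) (λ i q → drop-there (h (suc i) q)))

elems-length : ∀ {m} (p : Subset m) → length (elems p) ≤ ∣ p ∣
elems-length p = filter-tabulate-length p (_∈ₛ? p) id (λ _ → id)

∈-elems : ∀ {m} {p : Subset m} {x} → x ∈ₛ p → x ∈ elems p
∈-elems {p = p} = ∈-filter⁺ (_∈ₛ? p) (∈-allFin _)

elems-∈ : ∀ {m} {p : Subset m} {x} → x ∈ elems p → x ∈ₛ p
elems-∈ {m} {p} = proj₂ ∘ ∈-filter⁻ (_∈ₛ? p) {xs = allFin m}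

module Rooted {G : Graph} (D : TreeDecomposition G) (r : V (T D)) where

  rooted : ∀ t → ∃ λ l → Path (T D) t r l
  rooted t = reach-path (T D) (proj₂ (proj₁ (proj₂ (T-tree D)) t r))

  addr : V (T D) → List (V (T D))
  addr t = t ∷ proj₁ (rooted t)

  addr-path : ∀ t → Path (T D) t r (proj₁ (rooted t))
  addr-path t = proj₂ (rooted t)

  -- Lists that do not start with an edge get the empty set, which keeps the size bound valid for
  -- all lists.
  adhesion : List (V (T D)) → List (V G)
  adhesion (t ∷ u ∷ _) with adj (T D) t u Bool.≟ true
  ... | yes _ = elems (bag D t ∩ bag D u)
  ... | no _ = []
  adhesion _ = []

  adhesion-size : ∀ {θ} → AdhesionAtMost D θ → ∀ f → length (adhesion f) ≤ θ
  adhesion-size h [] = z≤n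
  adhesion-size h (_ ∷ []) = z≤n
  adhesion-size h (t ∷ u ∷ _) with adj (T D) t u Bool.≟ true
  ... | yes e = ≤-trans (elems-length (bag D t ∩ bag D u)) (h t u e)
  ... | no _ = z≤n

  adhesion-∈ : ∀ {t u l v} → adj (T D) t u ≡ true → v ∈ₛ bag D t → v ∈ₛ bag D u → v ∈ adhesion (t ∷ u ∷ l)
  adhesion-∈ {t} {u} e vt vu with adj (T D) t u Bool.≟ true
  ... | yes _ = ∈-elems (x∈p∩q⁺ (vt , vu))
  ... | no ne = ⊥-elim (ne e)

  ∈-adhesion : ∀ {t u l v} → v ∈ adhesion (t ∷ u ∷ l) → v ∈ₛ bag D t × v ∈ₛ bag D u
  ∈-adhesion {t} {u} i with adj (T D) t u Bool.≟ true
  ... | yes _ = x∈p∩q⁻ (bag D t) (bag D u) (elems-∈ i)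

  Bag : List (V (T D)) → V G → Set
  Bag [] v = ⊥
  Bag (t ∷ _) v = v ∈ₛ bag D t

  adhesion-bag : ∀ {a f s} → s ∈ adhesion (a ∷ f) → Bag f s
  adhesion-bag {f = _ ∷ l} i = proj₂ (∈-adhesion {l = l} i)

  _⊑?′_ : (k l : List (V (T D))) → Dec (k ⊑ l)
  _⊑?′_ = _⊑?_ Fin._≟_

  -- A tree walk leaving the subtree below `f` traverses the edge from `f` to its parent, and every
  -- bag along the walk contains `v`.
  crossing-∈ : ∀ {f a b v} → PathIn (T D) (λ s → v ∈ₛ bag D s) a b → f ⊑ addr a → ¬ f ⊑ addr b →
    v ∈ adhesion f
  crossing-∈ (stop _) fa fb = ⊥-elim (fb fa)
  crossing-∈ {f} (step {x = x} {y} vx e p) fx fb with f ⊑?′ addr y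
  ... | yes fy = crossing-∈ p fy fb
  ... | no fy with path-edge (T D) (proj₂ (proj₂ (T-tree D))) e (addr-path x) (addr-path y)
  ...   | inj₂ eq = ⊥-elim (fy (subst (f ⊑_) (cong (y ∷_) (sym eq)) (skip fx)))
  ...   | inj₁ eq with subst (f ⊑_) (cong (x ∷_) eq) fx
  ...     | skip fy' = ⊥-elim (fy fy')
  ...     | stop = adhesion-∈ {l = proj₁ (rooted y)} e vx (start p)
    where
    start : ∀ {P a b} → PathIn (T D) P a b → P a
    start (stop p) = p
    start (step p _ _) = p

  split-∈ : ∀ {f a b v} → v ∈ₛ bag D a → v ∈ₛ bag D b → f ⊑ addr a → ¬ f ⊑ addr b → v ∈ adhesion f
  split-∈ va vb = crossing-∈ (connect D _ _ _ va vb)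

  home : V G → List (V (T D))
  home v = addr (proj₁ (covers D v))

  home-∈ : ∀ v → v ∈ₛ bag D (proj₁ (covers D v))
  home-∈ v = proj₂ (covers D v)

  -- Take the first edge of the walk along which the home leaves the subtree of `f`. Some bag
  -- contains both ends of this edge; the side on which that bag lies decides which end belongs to
  -- the adhesion set.
  home-sep : ∀ {k f x y} → f ⊑ home x → ¬ f ⊑ home y → Reach G k x y →
    ∃ λ s → s ∈ adhesion f × Reach G k x s × Reach G k s y
  home-sep fx fy here = ⊥-elim (fy fx)
  home-sep {f = f} fx fy (step {k = k} {x = x} {y = z} e p) with f ⊑?′ home z
  ... | yes fz =
    let s , s∈ , q , q' = home-sep fz fy p in s , s∈ , step e q , reach-mono (n≤1+n k) q'
  ... | no fz with edges D x z e
  ...   | w , xw , zw with f ⊑?′ addr w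
  ...     | yes fw = z , split-∈ zw (home-∈ z) fw fz , step e here , reach-mono (n≤1+n k) p
  ...     | no fw = x , split-∈ (home-∈ x) xw fx fw , here , step e p

  layout : ∀ {θ σ} → AdhesionAtMost D θ → Layout G Bag 0 σ θ
  layout h = record
    { A = λ _ → ⊤ ; A? = λ _ → yes tt ; home = home ; S = adhesion
    ; S-size = adhesion-size h ; S-bag = adhesion-bag
    ; home-bag = λ {x} _ → x , home-∈ x , here
    ; sep = λ _ _ _ fx fy p → home-sep fx fy p }

-- Bags modelled by graphs of `F'`.

fromDoes : ∀ {P : Set} (P? : Dec P) → does P? ≡ true → P
fromDoes (yes p) _ = p

data Split (k m : ℕ) : Fin (k + m) → Set where
  old : ∀ a → Split k m (a ↑ˡ m)
  new : ∀ j → Split k m (k ↑ʳ j)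

split : ∀ k m x → Split k m x
split k m x with splitAt k x in eq
... | inj₁ a = subst (Split k m) (Fin.splitAt⁻¹-↑ˡ {k} eq) (old a)
... | inj₂ j = subst (Split k m) (Fin.splitAt⁻¹-↑ʳ {k} eq) (new j)

module _ (B : Graph) (m : ℕ) (N : Fin m → V B → Bool) where

  extend-old : ∀ a b → adj (Extend B m N) (a ↑ˡ m) (b ↑ˡ m) ≡ adj B a b
  extend-old a b rewrite Fin.splitAt-↑ˡ (n B) a m | Fin.splitAt-↑ˡ (n B) b m = refl

  extend-new : ∀ j a → adj (Extend B m N) (n B ↑ʳ j) (a ↑ˡ m) ≡ N j a
  extend-new j a rewrite Fin.splitAt-↑ʳ (n B) m j | Fin.splitAt-↑ˡ (n B) a m = refl

  extend-new-new : ∀ i j → adj (Extend B m N) (n B ↑ʳ i) (n B ↑ʳ j) ≡ false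
  extend-new-new i j rewrite Fin.splitAt-↑ʳ (n B) m i | Fin.splitAt-↑ʳ (n B) m j = refl

-- The bag of t, with the metric of G at scale R, is modelled by the extension of G[X_t] that has one
-- new vertex for each pair of vertices in an adhesion set of t at distance at most R in G.
module Bagged {G : Graph} (D : TreeDecomposition G) (t : V (T D)) (R : ℕ) where

  -- Rooting at `t` makes each subtree hanging off `t` the set of nodes below some `s ∷ t ∷ []`.
  open Rooted D t

  B : Graph
  B = Induced G (bag D t)

  at : V B → V G
  at = lookup (elems (bag D t))

  at-∈ : ∀ a → at a ∈ₛ bag D t
  at-∈ a = elems-∈ (∈-lookup {xs = elems (bag D t)} a)

  at-injective : ∀ {a b} → at a ≡ at b → a ≡ b
  at-injective = lookup-injective (filter⁺ (_∈ₛ? bag D t) (allFin⁺ _)) _ _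

  idx : ∀ {v} → v ∈ₛ bag D t → ∃ λ a → at a ≡ v
  idx i = index (∈-elems i) , sym (lookup-index (∈-elems i))

  Triple : Set
  Triple = V (T D) × V B × V B

  Shortcut : Triple → Set
  Shortcut (s , a , b) =
    adj (T D) t s ≡ true × at a ∈ₛ bag D s × at b ∈ₛ bag D s × Reach G R (at a) (at b)

  shortcut? : ∀ x → Dec (Shortcut x)
  shortcut? (s , a , b) = (adj (T D) t s Bool.≟ true) ×-dec
    ((at a ∈ₛ? bag D s) ×-dec ((at b ∈ₛ? bag D s) ×-dec reach? R (at a) (at b)))

  triples : List Triple
  triples = cartesianProduct (allFin _) (cartesianProduct (allFin _) (allFin _))

  shortcuts : List Triple
  shortcuts = filter shortcut? triples

  m : ℕ
  m = length shortcuts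

  is-shortcut : ∀ j → Shortcut (lookup shortcuts j)
  is-shortcut j = proj₂ (∈-filter⁻ shortcut? {xs = triples} (∈-lookup {xs = shortcuts} j))

  End : Triple → V B → Set
  End (_ , a , b) z = z ≡ a ⊎ z ≡ b

  end? : ∀ x z → Dec (End x z)
  end? (_ , a , b) z = (z Fin.≟ a) ⊎-dec (z Fin.≟ b)

  N : Fin m → V B → Bool
  N j z = does (end? (lookup shortcuts j) z)

  N-adhesion : ∀ j → ∃ λ s → adj (T D) t s ≡ true × (∀ a → N j a ≡ true → at a ∈ₛ bag D s)
  N-adhesion j with is-shortcut j
  ... | e , pa , pb , _ = _ , e , λ z nz → case fromDoes (end? (lookup shortcuts j) z) nz of λ where
    (inj₁ refl) → pa
    (inj₂ refl) → pb

  ends-close : ∀ j {a b} → N j a ≡ true → N j b ≡ true → Reach G R (at a) (at b)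
  ends-close j {a} {b} na nb with lookup shortcuts j | is-shortcut j
  ... | x | _ , _ , _ , p with fromDoes (end? x a) na | fromDoes (end? x b) nb
  ...   | inj₁ refl | inj₁ refl = here
  ...   | inj₁ refl | inj₂ refl = p
  ...   | inj₂ refl | inj₁ refl = reach-sym p
  ...   | inj₂ refl | inj₂ refl = here

  H : Graph
  H = Extend B m N

  old-edge : ∀ {a b} → adj G (at a) (at b) ≡ true → adj H (a ↑ˡ m) (b ↑ˡ m) ≡ true
  old-edge {a} {b} e = trans (extend-old B m N a b) e

  shortcut : ∀ {s a b} → Shortcut (s , a , b) → Reach H 2 (a ↑ˡ m) (b ↑ˡ m)
  shortcut {s} {a} {b} sc = step (trans (adj-sym H (a ↑ˡ m) (n B ↑ʳ j)) (edge (inj₁ refl)))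
                              (step (edge (inj₂ refl)) here)
    where
    i : (s , a , b) ∈ shortcuts
    i = ∈-filter⁺ shortcut?
      (∈-cartesianProduct⁺ (∈-allFin s) (∈-cartesianProduct⁺ (∈-allFin a) (∈-allFin b))) sc

    j = index i

    edge : ∀ {z} → End (s , a , b) z → adj H (n B ↑ʳ j) (z ↑ˡ m) ≡ true
    edge {z} ez = trans (extend-new B m N j z)
      (dec-true (end? (lookup shortcuts j) z) (subst (λ x → End x z) (lookup-index i) ez))

  branch : ∀ {w} → w ≢ t → ∃ λ s → adj (T D) t s ≡ true × (s ∷ t ∷ []) ⊑ addr w
  branch {w} ne = go ne (addr-path w)
    where
    go : ∀ {w l} → w ≢ t → Path (T D) w t l → ∃ λ s → adj (T D) t s ≡ true × (s ∷ t ∷ []) ⊑ w ∷ l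
    go ne stop = ⊥-elim (ne refl)
    go {w} ne (cons {v = v} e p _) with v Fin.≟ t
    ... | no ne' = let s , e' , le = go ne' p in s , e' , skip le
    go {w} ne (cons {v = v} e stop _) | yes _ = w , trans (adj-sym (T D) v w) e , stop
    go {w} ne (cons {v = v} e p@(cons _ p' n) _) | yes refl = ⊥-elim (n (path-end (T D) p'))

  outside : ∀ {s} → ¬ (s ∷ t ∷ []) ⊑ addr t
  outside le with addr-path t | ⊑-length le
  ... | p | le' with path-irrelevant (T D) (proj₂ (proj₂ (T-tree D))) p stop
  ...   | eq = 1+n≰n (≤-trans le' (≤-reflexive (cong (λ l → length (t ∷ l)) eq)))

  mutual

    -- Edges inside the bag are kept; an excursion outside becomes one shortcut, whose two edges are
    -- paid for by the edge returning to the bag.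
    contract : ∀ {k a y} → k ≤ R → Reach G k (at a) y → ∀ b → at b ≡ y →
      Reach H (k + k) (a ↑ˡ m) (b ↑ˡ m)
    contract _ here b eq with at-injective eq
    ... | refl = here
    contract {suc k} {a} k≤R (step {y = z} e p) b eq with z ∈ₛ? bag D t
    contract {suc k} {a} k≤R (step {y = z} e p) b eq | yes zt with idx zt
    ... | a' , refl = step (old-edge e)
      (reach-mono (+-monoʳ-≤ k (n≤1+n k)) (contract (≤-trans (n≤1+n k) k≤R) p b eq))
    contract {suc k} {a} k≤R (step {y = z} e p) b eq | no zt =
      let w , aw , zw = edges D (at a) z e
          s , st , fw = branch {w} λ eq → zt (subst (λ w → z ∈ₛ bag D w) eq zw)
      in reach-mono (+-mono-≤ (n≤1+n k) (n≤1+n k))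
           (excursion {i = 1} k≤R st (split-∈ aw (at-∈ a) fw outside) zt zw fw (step e here) p b eq)

    -- A walk that left the bag through the edge ts stays below this edge until it comes back.
    excursion : ∀ {i k s w a z y} → i + k ≤ R → adj (T D) t s ≡ true → at a ∈ adhesion (s ∷ t ∷ []) →
      ¬ z ∈ₛ bag D t → z ∈ₛ bag D w → (s ∷ t ∷ []) ⊑ addr w → Reach G i (at a) z →
      Reach G k z y → ∀ b → at b ≡ y → Reach H (k + k) (a ↑ˡ m) (b ↑ˡ m)
    excursion _ _ _ zt _ _ _ here b refl = ⊥-elim (zt (at-∈ b))
    excursion {i} {suc k} {s} {w} {a} {z} le st as zt zw fw q (step {y = z'} e p) b eq
      with edges D z z' e | z' ∈ₛ? bag D t
    ... | w' , zw' , z'w' | no z't =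
      reach-mono (+-mono-≤ (n≤1+n k) (n≤1+n k))
        (excursion {i = i + 1} (≤-trans (≤-reflexive (+-assoc i 1 k)) le) st as z't z'w'
          (stays zt zw fw zw') (reach-trans q (step e here)) p b eq)
    ... | w' , zw' , z'w' | yes z't with idx z't
    ...   | a' , refl = subst (λ l → Reach H l (a ↑ˡ m) (b ↑ˡ m)) (cong suc (sym (+-suc k k)))
      (reach-trans (shortcut {s}
        ( st
        , proj₁ (∈-adhesion {l = []} as)
        , proj₁ (∈-adhesion {l = []} (split-∈ z'w' z't (stays zt zw fw zw') outside))
        , reach-mono (≤-trans (+-monoʳ-≤ i (s≤s z≤n)) le) (reach-trans q (step e here))))
        (contract (≤-trans (≤-trans (n≤1+n k) (m≤n+m (suc k) i)) le) p b eq))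

    -- Bags containing `z` on both sides of the edge ts would force `z` into the bag of `t`.
    stays : ∀ {s w w' z} → ¬ z ∈ₛ bag D t → z ∈ₛ bag D w → (s ∷ t ∷ []) ⊑ addr w →
      z ∈ₛ bag D w' → (s ∷ t ∷ []) ⊑ addr w'
    stays {s} {w' = w'} zt zw fw zw' = decidable-stable ((s ∷ t ∷ []) ⊑?′ addr w') λ nf →
      zt (proj₂ (∈-adhesion {l = []} (split-∈ zw zw' fw nf)))

  mutual

    -- A new vertex joins only vertices at distance at most R in `G`, so a step in `H` is worth at
    -- most R + 1.
    expand : ∀ {k a b} → Reach H k (a ↑ˡ m) (b ↑ˡ m) → Reach G (k * suc R) (at a) (at b)
    expand {k} {a} {b} p = expand-old p refl

    expand-old : ∀ {k a b x} → Reach H k x (b ↑ˡ m) → x ≡ a ↑ˡ m → Reach G (k * suc R) (at a) (at b)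
    expand-old {a = a} {b} here eq with Fin.↑ˡ-injective m b a eq
    ... | refl = here
    expand-old {suc k} {a} {b} (step {y = y} e p) refl with split (n B) m y
    ... | old a' = step (trans (sym (extend-old B m N a a')) e)
      (reach-mono (m≤n+m (k * suc R) R) (expand-old p refl))
    ... | new j = reach-mono (m≤n+m (k * suc R) (suc R))
      (expand-new j p refl (trans (sym (extend-new B m N j a))
        (trans (adj-sym H (n B ↑ʳ j) (a ↑ˡ m)) e)))

    expand-new : ∀ {k a b x} j → Reach H k x (b ↑ˡ m) → x ≡ n B ↑ʳ j → N j a ≡ true →
      Reach G (k * suc R) (at a) (at b)
    expand-new {b = b} j here eq _ = ⊥-elim (old≢new eq)
      where
      old≢new : b ↑ˡ m ≢ n B ↑ʳ j
      old≢new eq with trans (sym (Fin.splitAt-↑ˡ (n B) b m))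
                               (trans (cong (splitAt (n B)) eq) (Fin.splitAt-↑ʳ (n B) m j))
      ... | ()
    expand-new {suc k} {a} j (step {y = y} e p) refl na with split (n B) m y
    ... | new j' with trans (sym e) (extend-new-new B m N j j')
    ...   | ()
    expand-new {suc k} {a} j (step e p) refl na | old a' =
      reach-mono (n≤1+n _)
        (reach-trans (ends-close j na (trans (sym (extend-new B m N j a')) e)) (expand-old p refl))

  module _ {d E : ℕ} (cH : V H → Fin (suc d))
    (cH-bounded : Bounded {H} (λ _ → ⊤) cH (suc (R + R)) E) where

    colour : V G → Fin (suc d)
    colour v with v ∈ₛ? bag D t
    ... | yes i = cH (proj₁ (idx i) ↑ˡ m)
    -- An arbitrary colour: only chains inside the bag are to be bounded.
    ... | no _ = zero

    colour-at : ∀ a → colour (at a) ≡ cH (a ↑ˡ m)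
    colour-at a with at a ∈ₛ? bag D t
    ... | yes i = cong (λ b → cH (b ↑ˡ m)) (at-injective (proj₂ (idx i)))
    ... | no ni = ⊥-elim (ni (at-∈ a))

    bag-chain : ∀ {a y} → Star (Linked {G} (_∈ₛ bag D t) (Tied R colour)) (at a) y →
      ∃ λ b → at b ≡ y × Star (Linked {H} (λ _ → ⊤) (Tied (suc (R + R)) cH)) (a ↑ˡ m) (b ↑ˡ m)
    bag-chain ε = _ , refl , ε
    bag-chain {a} ((_ , yt , eq , p) ◅ w) with idx yt
    ... | a' , refl =
      let b , eq' , w' = bag-chain w
      in b , eq' ,
        (tt , tt , trans (sym (colour-at a)) (trans eq (colour-at a')) ,
          reach-mono (n≤1+n _) (contract ≤-refl p a' refl)) ◅ w'

    colour-bounded : Bounded {G} (_∈ₛ bag D t) colour R (E * suc R)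
    colour-bounded ε = here
    colour-bounded w@((xt , _) ◅ _) with idx xt
    ... | a , refl with bag-chain w
    ...   | b , refl , w' = expand (cH-bounded w')

-- From covers to colourings and back.

cover-colouring : ∀ {F d f} → ControlFunction F d f → ∀ {G} → F G → ∀ r → 0 < r →
  ∃ λ (c : V G → Fin (suc d)) → Bounded {G} (λ _ → ⊤) c r (f r)
cover-colouring {f = f} ctl {G} FG r r>0 with ctl G FG r r>0
... | _ , U , cover , apart , small = c , bounded
  where
  c : V G → Fin _
  c x = proj₁ (cover x)

  -- Sets of one family are more than r apart, so a monochromatic chain never changes its set.
  same-set : ∀ {i j x y} → x ∈ₛ U i j → c x ≡ i → Star (Linked {G} (λ _ → ⊤) (Tied r c)) x y → y ∈ₛ U i j
  same-set xi _ ε = xi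
  same-set {j = j} {x} xi refl (_◅_ {j = z} (_ , _ , eq , p) w) = same-set zi (sym eq) w
    where
    zi : z ∈ₛ U (c x) j
    zi with subst (λ i → ∃ λ j → z ∈ₛ U i j) (sym eq) (proj₂ (cover z))
    ... | j' , zj with j Fin.≟ j'
    ...   | yes refl = zj
    ...   | no ne = ⊥-elim (apart _ _ _ _ _ ne xi zj p)

  bounded : Bounded {G} (λ _ → ⊤) c r (f r)
  bounded {x} w = let _ , xi = proj₂ (cover x) in small _ _ _ _ xi (same-set xi refl w)

-- Each vertex borrows the colour of a vertex of `P` within β, which lengthens jumps by at most 2β.
thicken : ∀ {m} {G : Graph} {P : V G → Set} (P? : ∀ x → Dec (P x)) β {r D} (c : V G → Fin (suc m)) →
  Bounded {G} P c (r + (β + β)) D →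
  ∃ λ (c' : V G → Fin (suc m)) →
    Bounded {G} (λ x → ∃ λ y → P y × Reach G β x y) c' r (β + (D + β))
thicken {G = G} {P} P? β {r} {D} c b = c ∘ proj , bounded
  where
  P⁺ : V G → Set
  P⁺ x = ∃ λ y → P y × Reach G β x y

  near-P? : ∀ x → Dec (P⁺ x)
  near-P? x = Fin.any? λ y → P? y ×-dec reach? β x y

  proj : V G → V G
  proj x with near-P? x
  ... | yes (y , _) = y
  ... | no _ = x

  proj-P : ∀ {x} → P⁺ x → P (proj x) × Reach G β x (proj x)
  proj-P {x} h with near-P? x
  ... | yes (_ , p) = p
  ... | no nh = ⊥-elim (nh h)

  link : ∀ {x y} → Linked {G} P⁺ (Tied r (c ∘ proj)) x y → Linked {G} P (Tied (r + (β + β)) c) (proj x) (proj y)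
  link (hx , hy , eq , p) =
    let px , qx = proj-P hx ; py , qy = proj-P hy
    in px , py , eq ,
       reach-mono (≤-reflexive
         (trans (cong (β +_) (+-comm r β)) (trans (sym (+-assoc β β r)) (+-comm (β + β) r))))
         (reach-trans (reach-sym qx) (reach-trans p qy))

  ends : ∀ {x y} → P⁺ x → Star (Linked {G} P⁺ (Tied r (c ∘ proj))) x y → P⁺ y
  ends h ε = h
  ends _ ((_ , h , _) ◅ w) = ends h w

  bounded : Bounded {G} P⁺ (c ∘ proj) r (β + (D + β))
  bounded ε = here
  bounded w@((hx , _) ◅ _) =
    reach-trans (proj₂ (proj-P hx))
      (reach-trans (b (Star-gmap proj link w)) (reach-sym (proj₂ (proj-P (ends hx w)))))

-- `R` absorbs the thickening by β. Jumps of R become 2R in the extension, and one more makes the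
-- scale positive; the factor `suc R` converts distances back to `G`.
bag-bound : (ℕ → ℕ) → ℕ → ℕ → ℕ
bag-bound f β r = let R = r + (β + β) in β + (f (suc (R + R)) * suc R + β)

bags-controlled : ∀ {F F' θ d f G} → ControlFunction F' d f → (good : GoodDecomposition F F' θ G) →
  let D = proj₁ good in
  Controlled (suc d) G (Rooted.Bag D (fromℕ< (proj₁ (T-tree D)))) (bag-bound f)
-- `[]` is the address of no node, and its `Bag` is empty.
bags-controlled ctl good [] β r = (λ _ → zero) , λ { ε → here ; ((() , _) ◅ _) }
bags-controlled {G = G} ctl (D , _ , _ , F'-extend) (t ∷ _) β r =
  let c , b = cover-colouring ctl (F'-extend t M.m M.N M.N-adhesion) (suc (R + R)) (s≤s z≤n)
  in thicken (_∈ₛ? bag D t) β (M.colour c b) (M.colour-bounded c b)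
  where
  R = r + (β + β)
  module M = Bagged D t R

-- The sets are the components of `Tied`, indexed by colour and representative; the remaining
-- indices give empty sets.
colouring-control : ∀ {d r D} {G : Graph} (c : V G → Fin (suc d)) → Bounded {G} (λ _ → ⊤) c r D →
  Σ (Fin (suc d) → ℕ) λ m → Σ ((i : Fin (suc d)) → Fin (m i) → Subset (n G)) λ U →
    (∀ x → ∃ λ i → ∃ λ j → x ∈ₛ U i j) ×
    (∀ i j j' x x' → j ≢ j' → x ∈ₛ U i j → x' ∈ₛ U i j' → ¬ Reach G r x x') ×
    (∀ i j x x' → x ∈ₛ U i j → x' ∈ₛ U i j → Reach G D x x')
colouring-control {r = r} {G = G} c b =
  (λ _ → n G) , U ,
  (λ x → c x , rep x , U-∈ (refl , refl)) ,
  (λ i j j' x x' ne xi x'i p →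
    let cx , rx = ∈-U xi ; cx' , rx' = ∈-U x'i
    in ne (trans (sym rx) (trans (rep-cong (trans cx (sym cx') , p)) rx'))) ,
  (λ i j x x' xi x'i →
    let _ , rx = ∈-U xi ; _ , rx' = ∈-U x'i
    in b (Star-map (λ e → tt , tt , e)
         (subst (Star (Tied r c) x) (trans rx (sym rx')) (rep-chain x)
           ◅◅ reverse tied-sym (rep-chain x'))))
  where
  reps = representatives (λ x y → (c x Fin.≟ c y) ×-dec reach? {G} r x y) tied-sym
  rep = proj₁ reps
  rep-cong = proj₁ (proj₂ reps)
  rep-chain = proj₂ (proj₂ reps)

  in-U? : ∀ i j x → Dec (c x ≡ i × rep x ≡ j)
  in-U? i j x = (c x Fin.≟ i) ×-dec (rep x Fin.≟ j)

  U : ∀ i → V G → Subset (n G)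
  U i j = Vec.tabulate (does ∘ in-U? i j)

  U-∈ : ∀ {i j x} → c x ≡ i × rep x ≡ j → x ∈ₛ U i j
  U-∈ {i} {j} {x} h = lookup⇒[]= x (U i j)
    (trans (lookup∘tabulate (does ∘ in-U? i j) x) (dec-true (in-U? i j x) h))

  ∈-U : ∀ {i j x} → x ∈ₛ U i j → c x ≡ i × rep x ≡ j
  ∈-U {i} {j} {x} h = fromDoes (in-U? i j x)
    (trans (sym (lookup∘tabulate (does ∘ in-U? i j) x)) ([]=⇒lookup h))

theorem5p2 : (F F' Fstar : Class) → Hereditary F → Hereditary F' →
    (θ : ℕ) → 0 < θ →
    (∀ G → Fstar G → GoodDecomposition F F' θ G) →
    ∀ d → 1 ≤ d → AsdimAtMost F d → AsdimAtMost F' d → AsdimAtMost Fstar d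
theorem5p2 F F' Fstar _ _ θ _ good (suc d) (s≤s _) _ (f , ctl) = bound , control
  where
  -- `β` starts at 0, as every vertex lies in the bag of its home. The dimension `suc d` provides
  -- the `2 + d` colours.
  main = λ r → layout-colouring {d} (bag-bound f) θ 0 r

  bound : ℕ → ℕ
  bound r = proj₁ (proj₂ (main r))

  control : ControlFunction Fstar (suc d) bound
  control G FG r _ =
    let gd@(D , adhesion≤θ , _) = good G FG
        c , b = proj₂ (proj₂ (main r)) Fin._≟_ _ (bags-controlled {F = F} ctl gd)
                  (Rooted.layout D (fromℕ< (proj₁ (T-tree D))) adhesion≤θ)
    in colouring-control c b
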